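{- Let $n\in\mathbb{N}$. If $\mathcal{L}$ is a finite set of rectangular polyominoes all of unit height, then $$\beta_n(\mathcal{L})\le\max\Big(2,\ \frac{3}{8}\,\omega^n\,\operatorname{lcm}\{w\mid w\in w(\mathcal{L})\}^2\Big),$$ where $\omega$ is the maximum width of any polyomino in $\mathcal{L}$.
   Context: $w(\mathcal{L})=\{k\mid \text{the }1\times k\text{ polyomino (height }1\text{, width }k)\text{ is in }\mathcal{L}\}$. $R_{n\times m}$ denotes the rectangular region of height $n$ and width $m$. A tiling of $R_{n\times m}$ by a multiset $T$ of polyominoes is a placement of translates of all elements of $T$ in $R_{n\times m}$ covering every point, with no two different elements having two-dimensional overlap; a tiling by elements of $\mathcal{L}$ is a tiling by a multiset with elements drawn from $\mathcal{L}$. A rearrangement of a tiling by $T$ is any tiling of $R_{n\times m}$ by the same multiset $T$. A tiling of $R_{n\times m}$ admits a subtiling if it has a rearrangement which is the side-by-side juxtaposition of a tiling of $R_{n\times m'}$ and a tiling of $R_{n\times m''}$ with $m=m'+m''$, $m',m''\neq 0$. $\beta_n(\mathcal{L})$ is the smallest natural number such that every tiling of $R_{n\times m}$ by elements of $\mathcal{L}$ with $m>\beta_n(\mathcal{L})$ admits a subtiling, and $\infty$ if no such number exists. -}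

module Defs where

open import Data.Empty using (⊥)
open import Data.Integer.Base using (+_)
open import Data.List.Base using (List; []; _∷_; _++_; map; filter; foldr)
open import Data.List.Extrema.Nat using (max)
open import Data.List.Membership.Propositional using (_∈_)
open import Data.List.Relation.Binary.Permutation.Propositional using (_↭_)
open import Data.List.Relation.Unary.All using (All)
open import Data.List.Relation.Unary.AllPairs using (AllPairs)
open import Data.List.Relation.Unary.Any using (Any)
open import Data.Nat.Base using (ℕ; _+_; _≤_; _<_; NonZero)
open import Data.Nat.LCM using (lcm)
open import Data.Nat.Properties using (_≟_)
open import Data.Product.Base using (_×_; ∃-syntax)
open import Data.Rational.Unnormalised.Base as ℚᵘ using (ℚᵘ)
open import Relation.Binary.PropositionalEquality using (_≡_)
open import Relation.Nullary.Construct.Add.Supremum using (_⁺; [_]; ⊤⁺)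
open import Relation.Nullary.Negation.Core using (¬_)

-- A rectangular polyomino, up to translation.  The non-zero proofs are
-- irrelevant, so equality is equality of the two dimensions.
record Rect : Set where
  constructor rect
  field
    height width : ℕ
    .{{height≢0}} : NonZero height
    .{{width≢0}}  : NonZero width

open Rect public

-- A translate of a tile; (row , col) is the cell of least coordinates.
-- Polyominoes live on the unit grid, so translates are by lattice vectors;
-- offsets are natural numbers because R_{n×m} is the set of cells (i , j)
-- with i < n and j < m.
record Placed : Set where
  constructor place
  field
    tile    : Rect
    row col : ℕ

open Placed public

Covers : ℕ → ℕ → Placed → Set
Covers i j p = (row p ≤ i × i < row p + height (tile p))
             × (col p ≤ j × j < col p + width (tile p))

Inside : ℕ → ℕ → Placed → Set
Inside n m p = row p + height (tile p) ≤ n × col p + width (tile p) ≤ m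

NonOverlapping : Placed → Placed → Set
NonOverlapping p q = ∀ i j → ¬ (Covers i j p × Covers i j q)

-- Finite sets and multisets are both represented by lists: sets are only
-- used through membership, multisets only up to ↭.
tiles : List Placed → List Rect
tiles = map tile

record IsTiling (n m : ℕ) (T : List Rect) (t : List Placed) : Set where
  field
    multiset : tiles t ↭ T
    inside   : All (Inside n m) t
    covering : ∀ i j → i < n → j < m → Any (Covers i j) t
    disjoint : AllPairs NonOverlapping t

IsTilingFrom : ℕ → ℕ → List Rect → List Placed → Set
IsTilingFrom n m L t = IsTiling n m (tiles t) t × All (_∈ L) (tiles t)

IsRearrangement : ℕ → ℕ → List Placed → List Placed → Set
IsRearrangement n m t t′ = IsTiling n m (tiles t) t′

shiftRight : ℕ → Placed → Placed
shiftRight d (place r i j) = place r i (d + j)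

juxtapose : ℕ → List Placed → List Placed → List Placed
juxtapose m′ t₁ t₂ = t₁ ++ map (shiftRight m′) t₂

IsJuxtaposition : ℕ → ℕ → List Placed → Set
IsJuxtaposition n m t =
  ∃[ m′ ] ∃[ m″ ] ∃[ t₁ ] ∃[ t₂ ]
    NonZero m′ × NonZero m″ × m ≡ m′ + m″
    × IsTiling n m′ (tiles t₁) t₁
    × IsTiling n m″ (tiles t₂) t₂
    × t ↭ juxtapose m′ t₁ t₂

AdmitsSubtiling : ℕ → ℕ → List Placed → Set
AdmitsSubtiling n m t =
  ∃[ t′ ] IsRearrangement n m t t′ × IsJuxtaposition n m t′

SubtilesBeyond : ℕ → List Rect → ℕ → Set
SubtilesBeyond n L b =
  ∀ m → b < m → ∀ t → IsTilingFrom n m L t → AdmitsSubtiling n m t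

-- Isβ n L x says β_n(L) = x, where ⊤⁺ is ∞.  It is a relation, not a
-- function, as choosing between a finite value and ∞ is not constructive.
Isβ : ℕ → List Rect → ℕ ⁺ → Set
Isβ n L [ b ] = SubtilesBeyond n L b × (∀ c → SubtilesBeyond n L c → b ≤ c)
Isβ n L ⊤⁺    = ∀ c → ¬ SubtilesBeyond n L c

fromℕ : ℕ → ℚᵘ
fromℕ k = + k ℚᵘ./ 1

infix 4 _≤∞_

_≤∞_ : ℕ ⁺ → ℚᵘ → Set
[ b ] ≤∞ q = fromℕ b ℚᵘ.≤ q
⊤⁺    ≤∞ q = ⊥

UnitHeight : Rect → Set
UnitHeight r = height r ≡ 1

w : List Rect → List ℕ
w L = map width (filter (λ r → height r ≟ 1) L)

-- Equal to 0 for the empty set.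
maxWidth : List Rect → ℕ
maxWidth L = max 0 (map width L)

lcmOf : List ℕ → ℕ
lcmOf = foldr lcm 1

-- A tiling by unit-height tiles is a list of n rows of total width m, up to
-- permutation of its tiles.  Let ℓ be the lcm of the widths and ω the largest
-- width.  If m > ω (ℓ - 1), then in each row the tiles of some width w have total
-- at least ℓ, and ℓ / w of them have total exactly ℓ.  Pulling these to the front
-- of each row splits off a tiling of width ℓ as soon as also m > ℓ.  For n ≥ 1 both
-- thresholds are below the claimed bound.  Below it, subtiling is decidable by
-- enumeration of the rows, so the least valid β can be found by search.

module Submission where

open import Data.Integer.Base using (+_)
import Data.Integer.Base as ℤ
import Data.Integer.Properties as ℤₚ
open import Data.List.Base
  using (List; []; _∷_; [_]; _++_; map; filter; concat; length; upTo; downFrom;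
         applyUpTo; cartesianProductWith)
open import Data.List.Extrema.Nat using (max≤v⁺; xs≤max)
import Data.List.Membership.DecPropositional as DecMembership
open import Data.List.Membership.Propositional using (_∈_; lose; find)
open import Data.List.Membership.Propositional.Properties
open import Data.List.Membership.Propositional.Properties.WithK using (unique∧set⇒bag)
open import Data.List.Properties
  using (map-++; map-∘; length-++; length-map; length-applyUpTo; length-upTo;
         length-downFrom; concat-map; ++-assoc; filter-all; filter-none)
open import Data.List.Relation.Binary.BagAndSetEquality using (∼bag⇒↭)
open import Data.List.Relation.Binary.Disjoint.Propositional using (Disjoint)
open import Data.List.Relation.Binary.Permutation.Propositional
  using (_↭_; prep; ↭-refl; ↭-sym; ↭-trans; ↭-reflexive; module PermutationReasoning)
open import Data.List.Relation.Binary.Permutation.Propositional.Properties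
  using (All-resp-↭; ∈-resp-↭; ¬x∷xs↭[]; shift; shifts; drop-∷; ↭-length)
  renaming (map⁺ to ↭-map⁺; ++⁺ to ↭-++⁺; ++⁺ˡ to ↭-++⁺ˡ)
open import Data.List.Relation.Unary.All as All using (All; []; _∷_)
open import Data.List.Relation.Unary.All.Properties as Allₚ using (all-filter)
open import Data.List.Relation.Unary.AllPairs as AllPairs using (AllPairs; []; _∷_)
import Data.List.Relation.Unary.AllPairs.Properties as AllPairsₚ
open import Data.List.Relation.Unary.Any as Any using (Any; here; there)
import Data.List.Relation.Unary.Any.Properties as Anyₚ
open import Data.List.Relation.Unary.Unique.Propositional using (Unique)
import Data.List.Relation.Unary.Unique.Propositional.Properties as Uniqueₚ
open import Data.Nat.Base
open import Data.Nat.Divisibility using (_∣_; divides; ∣⇒≤; ∣-trans)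
open import Data.Nat.GCD using (gcd)
open import Data.Nat.LCM using (lcm; m∣lcm[m,n]; n∣lcm[m,n]; gcd*lcm)
open import Data.Nat.ListAction using (sum)
open import Data.Nat.ListAction.Properties using (sum-++; sum-↭)
open import Data.Nat.Properties hiding (_≟_)
import Data.Nat.Properties as ℕₚ
open import Data.Nat.Solver using (module +-*-Solver)
open import Data.Product.Base using (_×_; _,_; proj₂; ∃-syntax)
open import Data.Rational.Unnormalised.Base as ℚᵘ using (ℚᵘ)
import Data.Rational.Unnormalised.Properties as ℚᵘₚ
open import Data.Sum.Base as Sum using (_⊎_; inj₁; inj₂)
open import Function.Base using (_∘_; id)
open import Function.Bundles using (mk⇔)
open import Relation.Binary.Definitions using (DecidableEquality)
open import Relation.Binary.PropositionalEquality
  using (_≡_; _≢_; refl; sym; trans; cong; cong₂; subst; module ≡-Reasoning)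
open import Relation.Nullary.Construct.Add.Supremum renaming ([_] to ⌊_⌋)
open import Relation.Nullary.Decidable using (Dec; yes; no; map′; _×-dec_; _→-dec_)
open import Relation.Nullary.Negation using (¬_; contradiction)
open import Relation.Unary using (Decidable)
open import Defs

private
  variable
    A : Set

-- Decidability

module _ (_≟_ : DecidableEquality A) where

  open DecMembership _≟_ using (_∈?_)

  -- Any occurrence of `x` in `ys` may be deleted: by `drop-∷` the choice does not affect the
  -- answer.
  ↭-dec : (xs ys : List A) → Dec (xs ↭ ys)
  ↭-dec []       []       = yes ↭-refl
  ↭-dec []       (_ ∷ _)  = no (¬x∷xs↭[] ∘ ↭-sym)
  ↭-dec (x ∷ xs) ys with x ∈? ys
  ... | no  x∉ys = no λ p → x∉ys (∈-resp-↭ p (here refl))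
  ... | yes x∈ys with as , bs , refl ← ∈-∃++ x∈ys =
    map′ (λ p → ↭-trans (prep x p) (↭-sym (shift x as bs)))
         (λ p → drop-∷ (↭-trans p (shift x as bs)))
         (↭-dec xs (as ++ bs))

module _ {P : A → Set} (P? : Decidable P) {xs : List A} (P⊆xs : ∀ {x} → P x → x ∈ xs) where

  -- The search is confined to `xs`, which contains everything satisfying `P`.
  ∃-dec : Dec (∃[ x ] P x)
  ∃-dec = map′ Any.satisfied (λ (_ , px) → lose (P⊆xs px) px) (Any.any? P? xs)

  ∀-dec : {Q : A → Set} → Decidable Q → Dec (∀ x → P x → Q x)
  ∀-dec Q? = map′ (λ all x px → All.lookup all (P⊆xs px) px)
                  (λ f → All.universal f xs)
                  (All.all? (λ x → P? x →-dec Q? x) xs)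

listsUpTo : List A → ℕ → List (List A)
listsUpTo xs zero    = [ [] ]
listsUpTo xs (suc k) = [] ∷ cartesianProductWith _∷_ xs (listsUpTo xs k)

∈-listsUpTo : ∀ {xs ys : List A} {k} → All (_∈ xs) ys → length ys ≤ k → ys ∈ listsUpTo xs k
∈-listsUpTo {k = zero}  []           _         = here refl
∈-listsUpTo {k = suc k} []           _         = here refl
∈-listsUpTo {k = suc k} (y∈xs ∷ ys⊆) (s≤s len) =
  there (∈-cartesianProductWith⁺ _∷_ y∈xs (∈-listsUpTo ys⊆ len))

-- Only single values are tested. The bound descends from `B` while `P` holds at it; where `P` first
-- fails, no smaller bound is valid, since it would assert `P` there.
leastBound : {P : ℕ → Set} → Decidable P → ∀ B → (∀ m → B < m → P m) →
  ∃[ b ] b ≤ B × (∀ m → b < m → P m) × (∀ c → (∀ m → c < m → P m) → b ≤ c)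
leastBound P? zero    beyond = 0 , ≤-refl , beyond , λ _ _ → z≤n
leastBound {P} P? (suc B) beyond = go (P? (suc B))
  where
  beyond-B : P (suc B) → ∀ m → B < m → P m
  beyond-B p m B<m with m≤n⇒m<n∨m≡n B<m
  ... | inj₁ 1+B<m = beyond m 1+B<m
  ... | inj₂ refl  = p

  go : Dec (P (suc B)) →
    ∃[ b ] b ≤ suc B × (∀ m → b < m → P m) × (∀ c → (∀ m → c < m → P m) → b ≤ c)
  go (no ¬p) = suc B , ≤-refl , beyond , λ c f → ≮⇒≥ λ c<b → ¬p (f (suc B) c<b)
  go (yes p) with b , b≤B , rest ← leastBound P? B (beyond-B p) = b , m≤n⇒m≤1+n b≤B , rest

_≟ᴿ_ : DecidableEquality Rect
rect h₁ w₁ ≟ᴿ rect h₂ w₂ =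
  map′ (λ { (refl , refl) → refl }) (λ { refl → refl , refl })
       (h₁ ℕₚ.≟ h₂ ×-dec w₁ ℕₚ.≟ w₂)

-- Rows

total : List Rect → ℕ
total r = sum (map width r)

total-++ : ∀ r s → total (r ++ s) ≡ total r + total s
total-++ r s = trans (cong sum (map-++ width r s)) (sum-++ (map width r) (map width s))

total-↭ : ∀ {r s} → r ↭ s → total r ≡ total s
total-↭ r↭s = sum-↭ (↭-map⁺ width r↭s)

0<width : ∀ x → 0 < width x
0<width (rect _ w {{_}} {{w≢0}}) = >-nonZero⁻¹ w {{w≢0}}

length≤total : ∀ r → length r ≤ total r
length≤total []      = z≤n
length≤total (x ∷ r) = +-mono-≤ (0<width x) (length≤total r)

-- The hypotheses make `P` the disjoint union of `Q` and `R`. This serves both to sort tiles by row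
-- and to set apart the tiles of greatest permitted width.
filter-partition : ∀ {P Q R : A → Set} (P? : Decidable P) (Q? : Decidable Q) (R? : Decidable R) →
  (∀ {x} → Q x → P x) → (∀ {x} → R x → P x) → (∀ {x} → Q x → ¬ R x) → (∀ {x} → P x → ¬ Q x → R x) →
  ∀ xs → filter P? xs ↭ filter Q? xs ++ filter R? xs
filter-partition P? Q? R? Q⇒P R⇒P Q⇒¬R P¬Q⇒R = go
  where
  go : ∀ xs → filter P? xs ↭ filter Q? xs ++ filter R? xs
  go [] = ↭-refl
  go (x ∷ xs) with Q? x | R? x | P? x
  ... | yes q | yes r | _     = contradiction r (Q⇒¬R q)
  ... | yes q | _     | no ¬p = contradiction (Q⇒P q) ¬p
  ... | _     | yes r | no ¬p = contradiction (R⇒P r) ¬p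
  ... | no ¬q | no ¬r | yes p = contradiction (P¬Q⇒R p ¬q) ¬r
  ... | no _  | no _  | no _  = go xs
  ... | yes _ | no _  | yes _ = prep x (go xs)
  ... | no _  | yes _ | yes _ = ↭-trans (prep x (go xs)) (↭-sym (shift x (filter Q? xs) (filter R? xs)))

-- `downFrom` puts the bucket of the largest value first, so each induction step separates
-- `f x < suc n` into `f x ≡ n` and `f x < n`.
concat-buckets : (f : A → ℕ) (xs : List A) (n : ℕ) →
  concat (map (λ i → filter (λ x → f x ℕₚ.≟ i) xs) (downFrom n)) ↭ filter (λ x → f x <? n) xs
concat-buckets f xs zero    = ↭-reflexive (sym (filter-none (λ x → f x <? 0) (All.universal (λ _ ()) xs)))
concat-buckets f xs (suc n) = ↭-trans (↭-++⁺ˡ _ (concat-buckets f xs n)) (↭-sym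
  (filter-partition (λ x → f x <? suc n) (λ x → f x ℕₚ.≟ n) (λ x → f x <? n)
    (λ { refl → ≤-refl }) m<n⇒m<1+n (λ { refl → <-irrefl refl })
    (λ f<1+n f≢n → ≤∧≢⇒< (≤-pred f<1+n) f≢n) xs))

constantPrefix : ∀ {k r} q → All (λ x → width x ≡ k) r → q * k ≤ total r →
  ∃[ a ] ∃[ b ] r ≡ a ++ b × total a ≡ q * k
constantPrefix {r = r} zero _ _ = [] , r , refl , refl
-- Here `le` forces `suc q * k` to be 0, so the empty prefix has the right total.
constantPrefix (suc q) [] le = [] , [] , refl , sym (n≤0⇒n≡0 le)
constantPrefix (suc q) (_∷_ {x} refl eqs) le
  with a , b , refl , eq ← constantPrefix q eqs (+-cancelˡ-≤ (width x) _ _ le) =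
  x ∷ a , b , refl , cong (λ t → width x + t) eq

-- Pigeonhole: if the tiles of each width had total at most ℓ - 1 = d, the row
-- would have total at most k d.  A width with total at least ℓ divides ℓ, so
-- some of its tiles have total exactly ℓ.
subrow : ∀ {d} k r → All (λ x → width x ≤ k) r → All (λ x → width x ∣ suc d) r → k * d < total r →
  ∃[ a ] ∃[ b ] r ↭ a ++ b × total a ≡ suc d
subrow zero    []      _         _ ()
subrow zero    (x ∷ r) (w≤0 ∷ _) _ _ = contradiction (<-≤-trans (0<width x) w≤0) λ ()
subrow {d} (suc k) r ≤k ∣ℓ big = go (suc d ≤? total wide)
  where
  wide? : Decidable (λ x → width x ≡ suc k)
  wide? x = width x ℕₚ.≟ suc k

  narrow? : Decidable (λ x → width x ≤ k)
  narrow? x = width x ≤? k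

  wide narrow : List Rect
  wide   = filter wide? r
  narrow = filter narrow? r

  r↭ : r ↭ wide ++ narrow
  r↭ = subst (_↭ wide ++ narrow) (filter-all (λ x → width x ≤? suc k) ≤k)
    (filter-partition (λ x → width x ≤? suc k) wide? narrow?
      ≤-reflexive m≤n⇒m≤1+n (λ w≡ w≤ → 1+n≰n (≤-trans (≤-reflexive (sym w≡)) w≤))
      (λ w≤ w≢ → ≤-pred (≤∧≢⇒< w≤ w≢)) r)

  tot : total r ≡ total wide + total narrow
  tot = trans (total-↭ r↭) (total-++ wide narrow)

  -- A total of at least `suc d` rules out the empty list; the divisibility is then read off the
  -- first tile.
  k∣ℓ : ∀ s → All (λ x → width x ≡ suc k) s → All (λ x → width x ∣ suc d) s → suc d ≤ total s → suc k ∣ suc d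
  k∣ℓ (_ ∷ _) (w≡ ∷ _) (w∣ ∷ _) _ = subst (_∣ suc d) w≡ w∣

  go : Dec (suc d ≤ total wide) → ∃[ a ] ∃[ b ] r ↭ a ++ b × total a ≡ suc d
  go (yes ℓ≤) with divides q eq ← k∣ℓ wide (all-filter wide? r) (Allₚ.filter⁺ wide? ∣ℓ) ℓ≤
    with a , b , split , ta ← constantPrefix q (all-filter wide? r) (≤-trans (≤-reflexive (sym eq)) ℓ≤) =
    a , b ++ narrow
    , ↭-trans r↭ (↭-reflexive (trans (cong (_++ narrow) split) (++-assoc a b narrow)))
    , trans ta (sym eq)
  -- The tiles of width `suc k` account for at most `d`, so the narrow ones keep a total above
  -- `k * d` and the induction on `k` applies.
  go (no ℓ≰) with a , b , split , ta ← subrow k narrow (all-filter narrow? r) (Allₚ.filter⁺ narrow? ∣ℓ)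
                    (+-cancelˡ-< d _ _ (<-≤-trans (<-≤-trans big (≤-reflexive tot))
                      (+-monoˡ-≤ (total narrow) (≤-pred (≰⇒> ℓ≰))))) =
    a , wide ++ b , ↭-trans r↭ (↭-trans (↭-++⁺ˡ wide split) (shifts wide a)) , ta

-- Tilings by unit-height tiles as lists of rows

Filling : ℕ → ℕ → List (List Rect) → Set
Filling n m rs = length rs ≡ n × All (λ r → total r ≡ m) rs

-- The counterpart of `AdmitsSubtiling` with all positions forgotten. For unit-height tiles the two
-- are equivalent, and this one can be decided.
SplitFilling : ℕ → ℕ → List Rect → Set
SplitFilling n m T = ∃[ a ] ∃[ b ] ∃[ rs ] ∃[ ss ]
  NonZero a × NonZero b × m ≡ a + b × Filling n a rs × Filling n b ss × T ↭ concat rs ++ concat ss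

filling? : ∀ n m → Decidable (Filling n m)
filling? n m rs = (length rs ℕₚ.≟ n) ×-dec All.all? (λ r → total r ℕₚ.≟ m) rs

fillings : ℕ → ℕ → List Rect → List (List (List Rect))
fillings n m T = listsUpTo (listsUpTo T m) n

-- Widths are positive, so a row of total `a` has at most `a` tiles. Enumerating up to `m` serves
-- every `a ≤ m` at once.
∈-fillings : ∀ {n a m T rs} → Filling n a rs → a ≤ m → All (_∈ T) (concat rs) → rs ∈ fillings n m T
∈-fillings (len , tots) a≤m rs⊆T =
  ∈-listsUpTo (All.zipWith (λ {r} (t≡a , r⊆T) →
                  ∈-listsUpTo r⊆T (≤-trans (length≤total r) (≤-trans (≤-reflexive t≡a) a≤m)))
                (tots , Allₚ.concat⁻ rs⊆T))
              (≤-reflexive len)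

-- All four witnesses range over finite lists: `a` and `b` are at most `m` because `m ≡ a + b`, and
-- the permutation makes `rs` and `ss` use only tiles of `T`.
splitFilling? : ∀ n m → Decidable (SplitFilling n m)
splitFilling? n m T =
  ∃-dec (λ a → ∃-dec (λ b → ∃-dec (λ rs → ∃-dec (λ ss →
      nonZero? a ×-dec nonZero? b ×-dec (m ℕₚ.≟ a + b) ×-dec filling? n a rs ×-dec filling? n b ss
        ×-dec ↭-dec _≟ᴿ_ T (concat rs ++ concat ss))
    {fillings n m T}
    λ (_ , _ , m≡ , _ , fs , T↭) → ∈-fillings fs (≤-trans (m≤n+m b a) (≤-reflexive (sym m≡)))
       (Allₚ.++⁻ʳ (concat rs) (All-resp-↭ T↭ (All.tabulate id))))
    {fillings n m T}
    λ {rs} (_ , _ , _ , m≡ , fr , _ , T↭) → ∈-fillings fr (≤-trans (m≤m+n a b) (≤-reflexive (sym m≡)))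
       (Allₚ.++⁻ˡ (concat rs) (All-resp-↭ T↭ (All.tabulate id))))
    {upTo (suc m)}
    λ {b} (_ , _ , _ , _ , m≡ , _) → ∈-upTo⁺ (s≤s (≤-trans (m≤n+m b a) (≤-reflexive (sym m≡)))))
    {upTo (suc m)}
    λ {a} (b , _ , _ , _ , _ , m≡ , _) → ∈-upTo⁺ (s≤s (≤-trans (m≤m+n a b) (≤-reflexive (sym m≡))))

splitFilling-resp-↭ : ∀ {n m T T′} → T ↭ T′ → SplitFilling n m T → SplitFilling n m T′
splitFilling-resp-↭ T↭T′ (a , b , rs , ss , a≢0 , b≢0 , m≡ , fr , fs , T↭) =
  a , b , rs , ss , a≢0 , b≢0 , m≡ , fr , fs , ↭-trans (↭-sym T↭T′) T↭

-- Each row may be cut in its own way: the remainders all have total `b` by cancellation, and only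
-- the multiset of pieces matters.
cutRows : ∀ {a b} rs → All (λ r → total r ≡ a + b) rs →
  All (λ r → ∃[ r₁ ] ∃[ r₂ ] r ↭ r₁ ++ r₂ × total r₁ ≡ a) rs →
  ∃[ rs₁ ] ∃[ rs₂ ] Filling (length rs) a rs₁ × Filling (length rs) b rs₂ × concat rs ↭ concat rs₁ ++ concat rs₂
cutRows [] [] [] = [] , [] , (refl , []) , (refl , []) , ↭-refl
cutRows {a} {b} (r ∷ rs) (t ∷ ts) ((r₁ , r₂ , r↭ , t₁) ∷ cuts)
  with rs₁ , rs₂ , (l₁ , f₁) , (l₂ , f₂) , rs↭ ← cutRows rs ts cuts =
  r₁ ∷ rs₁ , r₂ ∷ rs₂ , (cong suc l₁ , t₁ ∷ f₁) , (cong suc l₂ , t₂ ∷ f₂) , (begin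
    r ++ concat rs                                ↭⟨ ↭-++⁺ r↭ rs↭ ⟩
    (r₁ ++ r₂) ++ (concat rs₁ ++ concat rs₂)      ≡⟨ ++-assoc r₁ r₂ _ ⟩
    r₁ ++ (r₂ ++ (concat rs₁ ++ concat rs₂))      ↭⟨ ↭-++⁺ˡ r₁ (shifts r₂ (concat rs₁)) ⟩
    r₁ ++ (concat rs₁ ++ (r₂ ++ concat rs₂))      ≡⟨ ++-assoc r₁ (concat rs₁) _ ⟨
    (r₁ ++ concat rs₁) ++ (r₂ ++ concat rs₂)      ∎)
  where
  open PermutationReasoning
  t₂ : total r₂ ≡ b
  t₂ = +-cancelˡ-≡ a _ _ (trans (cong (_+ total r₂) (sym t₁))
         (trans (sym (total-++ r₁ r₂)) (trans (sym (total-↭ r↭)) t)))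

-- From fillings to tilings

-- One shift for both directions. For `d = 0` it agrees definitionally with `shiftRight e`, so the
-- same construction yields `juxtapose`.
shiftBy : ℕ → ℕ → Placed → Placed
shiftBy d e (place x i j) = place x (d + i) (e + j)

tiles-++-shiftBy : ∀ d e t u → tiles (t ++ map (shiftBy d e) u) ≡ tiles t ++ tiles u
tiles-++-shiftBy d e t u = trans (map-++ tile t _) (cong (tiles t ++_) (sym (map-∘ u)))

private
  Span : ℕ → ℕ → ℕ → Set
  Span c l k = c ≤ k × k < c + l

  span-shift⁺ : ∀ d {c l k} → Span c l k → Span (d + c) l (d + k)
  span-shift⁺ d {c} {l} (c≤k , k<) = +-monoʳ-≤ d c≤k , <-≤-trans (+-monoʳ-< d k<) (≤-reflexive (sym (+-assoc d c l)))

  span-shift⁻ : ∀ d {c l k} → Span (d + c) l k → ∃[ k′ ] k ≡ d + k′ × Span c l k′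
  span-shift⁻ d {c} {l} {k} (c≤k , k<) = k ∸ d , sym d+k′ ,
    +-cancelˡ-≤ d _ _ (≤-trans c≤k (≤-reflexive (sym d+k′))) ,
    +-cancelˡ-< d _ _ (<-≤-trans (≤-<-trans (≤-reflexive d+k′) k<) (≤-reflexive (+-assoc d c l)))
    where
    d+k′ : d + (k ∸ d) ≡ k
    d+k′ = m+[n∸m]≡n (≤-trans (m≤m+n d c) c≤k)

covers-shift⁺ : ∀ d e {i j p} → Covers i j p → Covers (d + i) (e + j) (shiftBy d e p)
covers-shift⁺ d e (r , c) = span-shift⁺ d r , span-shift⁺ e c

covers-shift⁻ : ∀ d e {i j} p → Covers i j (shiftBy d e p) →
  ∃[ i′ ] ∃[ j′ ] i ≡ d + i′ × j ≡ e + j′ × Covers i′ j′ p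
covers-shift⁻ d e p (r , c) with i′ , i≡ , r′ ← span-shift⁻ d r | j′ , j≡ , c′ ← span-shift⁻ e c =
  i′ , j′ , i≡ , j≡ , r′ , c′

-- A cell common to the shifted tiles pulls back along each of them, and injectivity of the shift
-- identifies the two preimages.
nonOverlapping-shift : ∀ d e {p q} → NonOverlapping p q → NonOverlapping (shiftBy d e p) (shiftBy d e q)
nonOverlapping-shift d e {p} {q} p#q i j (cp , cq)
  with i′ , j′ , refl , refl , cp′ ← covers-shift⁻ d e p cp
  with i″ , j″ , i≡ , j≡ , cq′ ← covers-shift⁻ d e q cq
  with refl ← +-cancelˡ-≡ d i′ i″ i≡ | refl ← +-cancelˡ-≡ e j′ j″ j≡ = p#q i′ j′ (cp′ , cq′)

retile : ∀ {n m T T′ t} → T ↭ T′ → IsTiling n m T t → IsTiling n m T′ t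
retile T↭T′ τ = record
  { multiset = ↭-trans (IsTiling.multiset τ) T↭T′
  ; inside   = IsTiling.inside τ
  ; covering = IsTiling.covering τ
  ; disjoint = IsTiling.disjoint τ
  }

-- Common source of `beside` and `below`. The covering hypothesis says that the two blocks fill the
-- large rectangle; the last one says that the shift clears the first block, vertically or
-- horizontally.
assemble : ∀ {n a n′ b N M S T t u} d e → IsTiling n a S t → IsTiling n′ b T u →
  n ≤ N → a ≤ M → d + n′ ≤ N → e + b ≤ M →
  (∀ i j → i < N → j < M →
     (i < n × j < a) ⊎ (∃[ i′ ] ∃[ j′ ] i ≡ d + i′ × j ≡ e + j′ × i′ < n′ × j′ < b)) →
  n ≤ d ⊎ a ≤ e → IsTiling N M (S ++ T) (t ++ map (shiftBy d e) u)
assemble {n} {a} {n′} {b} {N} {M} {S} {T} {t} {u} d e τ υ n≤N a≤M d+n′≤N e+b≤M cover apart = record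
  { multiset = ↭-trans (↭-reflexive (tiles-++-shiftBy d e t u))
                       (↭-++⁺ (IsTiling.multiset τ) (IsTiling.multiset υ))
  ; inside   = Allₚ.++⁺ (All.map (λ (r , c) → ≤-trans r n≤N , ≤-trans c a≤M) (IsTiling.inside τ))
                        (Allₚ.map⁺ (All.map (λ {p} → shiftInside p) (IsTiling.inside υ)))
  ; covering = λ i j i<N j<M → covering i j (cover i j i<N j<M)
  ; disjoint = AllPairsₚ.++⁺ (IsTiling.disjoint τ)
                 (AllPairsₚ.map⁺ (AllPairs.map (λ {p} {q} → nonOverlapping-shift d e {p} {q}) (IsTiling.disjoint υ)))
                 (All.map (λ {p} ins → Allₚ.map⁺ (All.universal (λ q → separate p q ins apart) u)) (IsTiling.inside τ))
  }
  where
  shiftInside : ∀ p → Inside n′ b p → Inside N M (shiftBy d e p)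
  shiftInside p (r , c) =
    ≤-trans (≤-reflexive (+-assoc d _ _)) (≤-trans (+-monoʳ-≤ d r) d+n′≤N) ,
    ≤-trans (≤-reflexive (+-assoc e _ _)) (≤-trans (+-monoʳ-≤ e c) e+b≤M)

  covering : ∀ i j → (i < n × j < a) ⊎ (∃[ i′ ] ∃[ j′ ] i ≡ d + i′ × j ≡ e + j′ × i′ < n′ × j′ < b) →
    Any (Covers i j) (t ++ map (shiftBy d e) u)
  covering i j (inj₁ (i<n , j<a)) = Anyₚ.++⁺ˡ (IsTiling.covering τ i j i<n j<a)
  covering _ _ (inj₂ (i′ , j′ , refl , refl , i′<n′ , j′<b)) =
    Anyₚ.++⁺ʳ t (Anyₚ.map⁺ (Any.map (λ {p} → covers-shift⁺ d e {p = p}) (IsTiling.covering υ i′ j′ i′<n′ j′<b)))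

  separate : ∀ p q → Inside n a p → n ≤ d ⊎ a ≤ e → NonOverlapping p (shiftBy d e q)
  separate p q (r , c) (inj₁ n≤d) i j (((_ , i<) , _) , ((d≤ , _) , _)) =
    <⇒≱ (<-≤-trans i< (≤-trans r n≤d)) (≤-trans (m≤m+n d _) d≤)
  separate p q (r , c) (inj₂ a≤e) i j ((_ , (_ , j<)) , (_ , (e≤ , _))) =
    <⇒≱ (<-≤-trans j< (≤-trans c a≤e)) (≤-trans (m≤m+n e _) e≤)

private
  split-< : ∀ a {b k} → k < a + b → k < a ⊎ (∃[ k′ ] k ≡ a + k′ × k′ < b)
  split-< a {b} {k} k<a+b with k <? a
  ... | yes k<a = inj₁ k<a
  ... | no  k≮a = inj₂ (k ∸ a , sym a+k′ , +-cancelˡ-< a _ _ (≤-<-trans (≤-reflexive a+k′) k<a+b))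
    where
    a+k′ : a + (k ∸ a) ≡ k
    a+k′ = m+[n∸m]≡n (≮⇒≥ k≮a)

beside : ∀ {n a b S T t u} → IsTiling n a S t → IsTiling n b T u →
  IsTiling n (a + b) (S ++ T) (juxtapose a t u)
beside {n} {a} {b} τ υ = assemble 0 a τ υ ≤-refl (m≤m+n a b) ≤-refl ≤-refl cover (inj₂ ≤-refl)
  where
  cover : ∀ i j → i < n → j < a + b →
    (i < n × j < a) ⊎ (∃[ i′ ] ∃[ j′ ] i ≡ i′ × j ≡ a + j′ × i′ < n × j′ < b)
  cover i j i<n j<a+b with split-< a j<a+b
  ... | inj₁ j<a             = inj₁ (i<n , j<a)
  ... | inj₂ (j′ , eq , j′<b) = inj₂ (i , j′ , refl , eq , i<n , j′<b)

below : ∀ {n n′ m S T t u} → IsTiling n m S t → IsTiling n′ m T u →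
  IsTiling (n + n′) m (S ++ T) (t ++ map (shiftBy n 0) u)
below {n} {n′} {m} τ υ = assemble n 0 τ υ (m≤m+n n n′) ≤-refl ≤-refl ≤-refl cover (inj₁ ≤-refl)
  where
  cover : ∀ i j → i < n + n′ → j < m →
    (i < n × j < m) ⊎ (∃[ i′ ] ∃[ j′ ] i ≡ n + i′ × j ≡ j′ × i′ < n′ × j′ < m)
  cover i j i<n+n′ j<m with split-< n i<n+n′
  ... | inj₁ i<n              = inj₁ (i<n , j<m)
  ... | inj₂ (i′ , eq , i′<n′) = inj₂ (i′ , j , eq , refl , i′<n′ , j<m)

singleTiling : ∀ x → IsTiling (height x) (width x) [ x ] [ place x 0 0 ]
singleTiling x = record
  { multiset = ↭-refl
  ; inside   = (≤-refl , ≤-refl) ∷ []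
  ; covering = λ i j i< j< → here ((z≤n , i<) , (z≤n , j<))
  ; disjoint = [] ∷ []
  }

rowTiling : ∀ {r} → All UnitHeight r → ∃[ t ] IsTiling 1 (total r) r t
rowTiling [] = [] , record
  { multiset = ↭-refl ; inside = [] ; covering = λ _ _ _ () ; disjoint = [] }
rowTiling (_∷_ {x} h≡1 hs) with t , τ ← rowTiling hs =
  -- Both blocks must have the same height, so the height of `x` is rewritten to 1.
  _ , beside (subst (λ h → IsTiling h (width x) [ x ] [ place x 0 0 ]) h≡1 (singleTiling x)) τ

filling⇒tiling : ∀ {n m rs} → All UnitHeight (concat rs) → Filling n m rs → ∃[ t ] IsTiling n m (concat rs) t
filling⇒tiling {rs = []} _ (refl , []) = [] , record
  { multiset = ↭-refl ; inside = [] ; covering = λ _ _ () ; disjoint = [] }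
filling⇒tiling {rs = r ∷ rs} unit (refl , refl ∷ tots)
  with t , τ ← rowTiling (Allₚ.++⁻ˡ r unit)
  with u , υ ← filling⇒tiling (Allₚ.++⁻ʳ r unit) (refl , tots) = _ , below τ υ

-- From tilings to fillings

-- The columns of the tiles of a row form a duplicate-free enumeration of 0, …, m - 1.
row-total : ∀ {m} i t → All (λ p → row p ≡ i) t → All (λ p → UnitHeight (tile p)) t →
  All (λ p → col p + width (tile p) ≤ m) t → (∀ j → j < m → Any (Covers i j) t) →
  AllPairs NonOverlapping t → total (tiles t) ≡ m
row-total {m} i t rows units ins covers disj = begin
  total (tiles t)                   ≡⟨ length-columns t ⟨
  length (concat (map columns t))   ≡⟨ ↭-length columns↭ ⟩
  length (upTo m)                   ≡⟨ length-upTo m ⟩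
  m                                 ∎
  where
  open ≡-Reasoning

  columns : Placed → List ℕ
  columns p = applyUpTo (λ k → col p + k) (width (tile p))

  length-columns : ∀ u → length (concat (map columns u)) ≡ total (tiles u)
  length-columns []      = refl
  length-columns (p ∷ u) = trans (length-++ (columns p))
    (cong₂ _+_ (length-applyUpTo _ (width (tile p))) (length-columns u))

  ∈-columns⁺ : ∀ {j} p → Covers i j p → j ∈ columns p
  ∈-columns⁺ {j} p (_ , col≤j , j<) = subst (_∈ columns p) (m+[n∸m]≡n col≤j)
    (∈-applyUpTo⁺ _ (+-cancelˡ-< (col p) _ _ (≤-<-trans (≤-reflexive (m+[n∸m]≡n col≤j)) j<)))

  ∈-columns⁻ : ∀ {j} p → row p ≡ i → UnitHeight (tile p) → j ∈ columns p → Covers i j p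
  ∈-columns⁻ p refl h≡1 j∈ with k , k< , refl ← ∈-applyUpTo⁻ _ j∈ =
    (≤-refl , ≤-reflexive (trans (+-comm 1 _) (cong (λ h → row p + h) (sym h≡1)))) ,
    m≤m+n _ k , +-monoʳ-< (col p) k<

  unique : Unique (concat (map columns t))
  unique = Uniqueₚ.concat⁺
    (Allₚ.map⁺ (All.universal (λ p → Uniqueₚ.applyUpTo⁺₁ _ _ λ k<l _ eq →
      <⇒≢ k<l (+-cancelˡ-≡ (col p) _ _ eq)) t))
    (AllPairsₚ.map⁺ (disjoint t rows units disj))
    where
    -- All these tiles lie in row `i`, so a shared column `j` would be a shared cell `(i , j)`.
    disjoint : ∀ u → All (λ p → row p ≡ i) u → All (λ p → UnitHeight (tile p)) u →
      AllPairs NonOverlapping u → AllPairs (λ p q → Disjoint (columns p) (columns q)) u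
    disjoint [] _ _ _ = []
    disjoint (p ∷ u) (rp ∷ ru) (hp ∷ hu) (p#u ∷ u#) =
      All.zipWith (λ {q} ((rq , hq) , p#q) {j} (j∈p , j∈q) →
          p#q i j (∈-columns⁻ p rp hp j∈p , ∈-columns⁻ q rq hq j∈q))
        (All.zip (ru , hu) , p#u)
      ∷ disjoint u ru hu u#

  -- Duplicate-free lists with the same members are permutations of each other, hence equally long.
  columns↭ : concat (map columns t) ↭ upTo m
  columns↭ = ∼bag⇒↭ (unique∧set⇒bag unique (Uniqueₚ.upTo⁺ m) (mk⇔ to from))
    where
    to : ∀ {j} → j ∈ concat (map columns t) → j ∈ upTo m
    to j∈ with p , p∈t , j∈p ← find (Anyₚ.map⁻ (∈-concat⁻ (map columns t) j∈))
          with (_ , _ , j<) ← ∈-columns⁻ p (All.lookup rows p∈t) (All.lookup units p∈t) j∈p =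
      ∈-upTo⁺ (<-≤-trans j< (All.lookup ins p∈t))
    from : ∀ {j} → j ∈ upTo m → j ∈ concat (map columns t)
    from j∈ = ∈-concat⁺ (Anyₚ.map⁺ (Any.map (λ {p} → ∈-columns⁺ p) (covers _ (∈-upTo⁻ j∈))))

-- A tile of unit height lies in a single row, so sorting the tiles by `row` gives `n` buckets, each
-- of which tiles its own row.
tiling⇒filling : ∀ {n m T t} → All UnitHeight T → IsTiling n m T t → ∃[ rs ] Filling n m rs × concat rs ↭ T
tiling⇒filling {n} {m} {T} {t} unit τ =
  map tiles buckets ,
  (len , Allₚ.map⁺ (Allₚ.map⁺ (All.tabulate λ i∈ → bucket-total _ (∈-downFrom⁻ i∈)))) , (begin
    concat (map tiles buckets)             ≡⟨ concat-map buckets ⟩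
    tiles (concat buckets)                 ↭⟨ ↭-map⁺ tile (concat-buckets row t n) ⟩
    tiles (filter (λ p → row p <? n) t)    ≡⟨ cong tiles (filter-all (λ p → row p <? n) rows) ⟩
    tiles t                                ↭⟨ IsTiling.multiset τ ⟩
    T                                      ∎)
  where
  open PermutationReasoning

  onRow? : ∀ i → Decidable (λ p → row p ≡ i)
  onRow? i p = row p ℕₚ.≟ i

  bucket : ℕ → List Placed
  bucket i = filter (onRow? i) t

  buckets : List (List Placed)
  buckets = map bucket (downFrom n)

  units : All (λ p → UnitHeight (tile p)) t
  units = Allₚ.map⁻ (All-resp-↭ (↭-sym (IsTiling.multiset τ)) unit)

  len : length (map tiles buckets) ≡ n
  len = trans (length-map tiles buckets) (trans (length-map bucket (downFrom n)) (length-downFrom n))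

  row<n : ∀ p → UnitHeight (tile p) × Inside n m p → row p < n
  row<n p (h≡1 , r , _) = ≤-trans (≤-reflexive (trans (+-comm 1 _) (cong (λ h → row p + h) (sym h≡1)))) r

  rows : All (λ p → row p < n) t
  rows = All.map (λ {p} → row<n p) (All.zip (units , IsTiling.inside τ))

  bucket-total : ∀ i → i < n → total (tiles (bucket i)) ≡ m
  bucket-total i i<n = row-total i (bucket i) (all-filter (onRow? i) t) (Allₚ.filter⁺ (onRow? i) units)
    (Allₚ.filter⁺ (onRow? i) (All.map proj₂ (IsTiling.inside τ))) covers (AllPairsₚ.filter⁺ (onRow? i) (IsTiling.disjoint τ))
    where
    covers : ∀ j → j < m → Any (Covers i j) (bucket i)
    covers j j<m with p , p∈t , c@((row≤i , i<) , _) ← find (IsTiling.covering τ i j i<n j<m) =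
      -- With height 1, `row p ≤ i < row p + 1` forces `row p ≡ i`, so the covering tile survives
      -- the filter.
      lose (∈-filter⁺ (onRow? i) p∈t (≤-antisym row≤i (≤-pred (≤-trans i<
        (≤-reflexive (trans (cong (λ h → row p + h) (All.lookup units p∈t)) (+-comm _ 1))))))) c

-- Subtilings

-- `SubtilesBeyond` at a single width, the form in which it can be decided and fed to `leastBound`.
Subtiles : ℕ → List Rect → ℕ → Set
Subtiles n L m = ∀ t → IsTilingFrom n m L t → AdmitsSubtiling n m t

splitFilling⇒subtiling : ∀ {n m t} → All UnitHeight (tiles t) → SplitFilling n m (tiles t) → AdmitsSubtiling n m t
splitFilling⇒subtiling unit (a , b , rs , ss , a≢0 , b≢0 , refl , fr , fs , T↭)
  with unit′ ← All-resp-↭ T↭ unit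
  with u , τ ← filling⇒tiling (Allₚ.++⁻ˡ (concat rs) unit′) fr
  with v , υ ← filling⇒tiling (Allₚ.++⁻ʳ (concat rs) unit′) fs =
  juxtapose a u v , retile (↭-sym T↭) (beside τ υ) ,
  a , b , u , v , a≢0 , b≢0 , refl ,
  retile (↭-sym (IsTiling.multiset τ)) τ , retile (↭-sym (IsTiling.multiset υ)) υ , ↭-refl

subtiling⇒splitFilling : ∀ {n m t} → All UnitHeight (tiles t) → AdmitsSubtiling n m t → SplitFilling n m (tiles t)
subtiling⇒splitFilling unit (t′ , ρ , a , b , u , v , a≢0 , b≢0 , m≡ , τ , υ , t′↭)
  with tiles↭ ← ↭-trans (↭-sym (IsTiling.multiset ρ))
                  (↭-trans (↭-map⁺ tile t′↭) (↭-reflexive (tiles-++-shiftBy 0 a u v)))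
  with unit′ ← All-resp-↭ tiles↭ unit
  with rs , fr , rs↭ ← tiling⇒filling (Allₚ.++⁻ˡ (tiles u) unit′) τ
  with ss , fs , ss↭ ← tiling⇒filling (Allₚ.++⁻ʳ (tiles u) unit′) υ =
  a , b , rs , ss , a≢0 , b≢0 , m≡ , fr , fs , ↭-trans tiles↭ (↭-sym (↭-++⁺ rs↭ ss↭))

FillingFrom : ℕ → ℕ → List Rect → List (List Rect) → Set
FillingFrom n m L rs = Filling n m rs × All (_∈ L) (concat rs)

fillings⇒subtiles : ∀ {n L m} → All UnitHeight L →
  (∀ rs → FillingFrom n m L rs → SplitFilling n m (concat rs)) → Subtiles n L m
fillings⇒subtiles unit split t (τ , t⊆L)
  with unit′ ← All.map (All.lookup unit) t⊆L
  with rs , f , rs↭ ← tiling⇒filling unit′ τ =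
  splitFilling⇒subtiling unit′
    (splitFilling-resp-↭ rs↭ (split rs (f , All-resp-↭ (↭-sym rs↭) t⊆L)))

subtiles⇒fillings : ∀ {n L m} → All UnitHeight L → Subtiles n L m →
  ∀ rs → FillingFrom n m L rs → SplitFilling n m (concat rs)
subtiles⇒fillings unit sub rs (f , rs⊆L)
  with unit′ ← All.map (All.lookup unit) rs⊆L
  with t , τ ← filling⇒tiling unit′ f
  with t↭ ← IsTiling.multiset τ =
  splitFilling-resp-↭ t↭ (subtiling⇒splitFilling (All-resp-↭ (↭-sym t↭) unit′)
    (sub t (retile (↭-sym t↭) τ , All-resp-↭ (↭-sym t↭) rs⊆L)))

-- Tilings are traded for fillings, of which only finitely many have tiles from `L` and rows of
-- total `m`.
subtiles? : ∀ n {L} → All UnitHeight L → Decidable (Subtiles n L)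
subtiles? n {L} unit m =
  map′ (fillings⇒subtiles unit) (subtiles⇒fillings unit)
    (∀-dec (λ rs → filling? n m rs ×-dec All.all? (_∈? L) (concat rs))
           (λ (f , rs⊆L) → ∈-fillings f ≤-refl rs⊆L)
           (λ rs → splitFilling? n m (concat rs)))
  where open DecMembership _≟ᴿ_ using (_∈?_)

-- The bound `ω * d < m` lets `subrow` cut a piece of total `suc d` from every row; `suc d < m`
-- leaves a remainder of positive width.
fillings-split : ∀ {n m ω d rs} → Filling n m rs →
  All (λ x → width x ≤ ω) (concat rs) → All (λ x → width x ∣ suc d) (concat rs) →
  suc d < m → ω * d < m → SplitFilling n m (concat rs)
fillings-split {m = m} {ω} {d} {rs} (refl , tots) ≤ω ∣ℓ ℓ<m ωd<m
  with m≡ ← sym (m+[n∸m]≡n (<⇒≤ ℓ<m))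
  with rs₁ , rs₂ , f₁ , f₂ , rs↭ ← cutRows rs (All.map (λ t → trans t m≡) tots)
         (All.zipWith (λ {r} ((t , w≤) , w∣) → subrow ω r w≤ w∣ (<-≤-trans ωd<m (≤-reflexive (sym t))))
           (All.zip (tots , Allₚ.concat⁻ ≤ω) , Allₚ.concat⁻ ∣ℓ)) =
  suc d , m ∸ suc d , rs₁ , rs₂ , _ , >-nonZero (m<n⇒0<n∸m ℓ<m) , m≡ , f₁ , f₂ , rs↭

-- With no rows the only filling is empty, and it splits as width 1 plus a remainder that `1 < m`
-- makes positive.
subtiles-rowless : ∀ {L m} → All UnitHeight L → 1 < m → Subtiles 0 L m
subtiles-rowless {m = suc m} unit (s≤s 0<m) = fillings⇒subtiles unit λ where
  [] _ → 1 , m , [] , [] , _ , >-nonZero 0<m , refl , (refl , []) , (refl , []) , ↭-refl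

subtiles-wide : ∀ {n L m d} → All UnitHeight L → All (λ x → width x ∣ suc d) L →
  suc d < m → maxWidth L * d < m → Subtiles n L m
subtiles-wide {L = L} unit ∣ℓ ℓ<m ωd<m = fillings⇒subtiles unit λ rs (f , rs⊆L) →
  fillings-split f (All.map (All.lookup (Allₚ.map⁻ (xs≤max 0 (map width L)))) rs⊆L)
    (All.map (All.lookup ∣ℓ) rs⊆L) ℓ<m ωd<m

-- The bound

lcm≢0 : ∀ m n .{{_ : NonZero m}} .{{_ : NonZero n}} → NonZero (lcm m n)
lcm≢0 m n = m*n≢0⇒n≢0 (gcd m n) {{subst NonZero (sym (gcd*lcm m n)) (m*n≢0 m n)}}

lcmOf-widths≢0 : ∀ L → NonZero (lcmOf (map width L))
lcmOf-widths≢0 []      = _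
lcmOf-widths≢0 (x ∷ L) = lcm≢0 (width x) _ {{>-nonZero (0<width x)}} {{lcmOf-widths≢0 L}}

∣lcmOf : ∀ ks → All (_∣ lcmOf ks) ks
∣lcmOf []       = []
∣lcmOf (k ∷ ks) = m∣lcm[m,n] k _ ∷ All.map (λ j∣ → ∣-trans j∣ (n∣lcm[m,n] k _)) (∣lcmOf ks)

-- The empty set has lcm 1, so any other lcm guarantees a tile.
maxWidth≢0 : ∀ L → lcmOf (map width L) ≢ 1 → NonZero (maxWidth L)
maxWidth≢0 []      ℓ≢1 = contradiction refl ℓ≢1
maxWidth≢0 (x ∷ L) _   = >-nonZero (<-≤-trans (0<width x) (All.head (xs≤max 0 (map width (x ∷ L)))))

w-unitHeight : ∀ {L} → All UnitHeight L → w L ≡ map width L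
w-unitHeight unit = cong (map width) (filter-all (λ r → height r ℕₚ.≟ 1) unit)

-- `B` is valid but perhaps not least. The alternatives are the two arguments of the maximum, the
-- second with its denominator 8 cleared.
threshold : ∀ n {L} → All UnitHeight L → ∀ ℓ .{{_ : NonZero ℓ}} → lcmOf (map width L) ≡ ℓ →
  ∃[ B ] (∀ m → B < m → Subtiles n L m) × (B ≤ 2 ⊎ 8 * B ≤ 3 * (maxWidth L ^ n * ℓ ^ 2))
threshold zero unit _ _ = 2 , (λ m 2<m → subtiles-rowless unit (<⇒≤ 2<m)) , inj₁ ≤-refl
threshold (suc n) {L} unit ℓ@(suc d) eq = go (ℓ ≤? 2)
  where
  ω = maxWidth L

  ∣ℓ : All (λ x → width x ∣ ℓ) L
  ∣ℓ = Allₚ.map⁻ (subst (λ l → All (_∣ l) (map width L)) eq (∣lcmOf (map width L)))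

  ω≤ℓ : ω ≤ ℓ
  ω≤ℓ = max≤v⁺ z≤n (Allₚ.map⁺ (All.map ∣⇒≤ ∣ℓ))

  -- Raising 8 to 9 = 3 * 3 lets one factor 3 be absorbed by `ℓ`; `ω ≥ 1` gives `ω ≤ ω ^ suc n`. The
  -- trailing `* 1` matches the unfolding of `ℓ ^ 2`.
  estimate : .{{NonZero ω}} → 3 ≤ ℓ → 8 * (ω * ℓ) ≤ 3 * (ω ^ suc n * ℓ ^ 2)
  estimate 3≤ℓ = begin
    8 * (ω * ℓ)               ≤⟨ *-monoˡ-≤ (ω * ℓ) (n≤1+n 8) ⟩
    9 * (ω * ℓ)               ≡⟨ solve 2 (λ x y →
                                   con 9 :* (x :* y) := con 3 :* (x :* (con 3 :* (y :* con 1)))) refl ω ℓ ⟩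
    3 * (ω * (3 * (ℓ * 1)))   ≤⟨ *-monoʳ-≤ 3
                                   (*-mono-≤ (m≤m*n ω (ω ^ n) {{m^n≢0 ω n}}) (*-monoˡ-≤ (ℓ * 1) 3≤ℓ)) ⟩
    3 * (ω ^ suc n * ℓ ^ 2)   ∎
    where
    open ≤-Reasoning
    open +-*-Solver

  go : Dec (ℓ ≤ 2) →
    ∃[ B ] (∀ m → B < m → Subtiles (suc n) L m) × (B ≤ 2 ⊎ 8 * B ≤ 3 * (ω ^ suc n * ℓ ^ 2))
  -- Here `ω ≤ ℓ ≤ 2` and `d ≤ 1`, so both `ℓ` and `ω * d` are at most 2.
  go (yes ℓ≤2) = 2 , (λ m 2<m → subtiles-wide unit ∣ℓ (≤-<-trans ℓ≤2 2<m)
    (≤-<-trans (*-mono-≤ (≤-trans ω≤ℓ ℓ≤2) (≤-pred ℓ≤2)) 2<m)) , inj₁ ≤-refl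
  -- The product `ω * ℓ` dominates both `ℓ`, as `ω` is nonzero, and `ω * d`.
  go (no ℓ≰2) = ω * ℓ , (λ m ωℓ<m → subtiles-wide unit ∣ℓ
      (≤-<-trans (m≤n*m ℓ ω) ωℓ<m) (≤-<-trans (*-monoʳ-≤ ω (n≤1+n d)) ωℓ<m)) , inj₂ (estimate (≰⇒> ℓ≰2))
    where
    instance
      ω≢0 : NonZero ω
      ω≢0 = maxWidth≢0 L λ ℓ≡1 → ℓ≰2 (≤-trans (≤-reflexive (trans (sym eq) ℓ≡1)) (n≤1+n 1))

-- Inequalities of unnormalised fractions are cross-multiplied: the second alternative compares
-- `b / 1` with `3 * X / 8`.
fromℕ≤⊔ : ∀ {b} X → b ≤ 2 ⊎ 8 * b ≤ 3 * X → fromℕ b ℚᵘ.≤ fromℕ 2 ℚᵘ.⊔ (((+ 3) ℚᵘ./ 8) ℚᵘ.* fromℕ X)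
fromℕ≤⊔ {b} X (inj₁ b≤2) = ℚᵘₚ.p≤q⇒p≤q⊔r _ (ℚᵘ.*≤* (ℤₚ.*-monoʳ-≤-nonNeg (+ 1) (ℤ.+≤+ b≤2)))
fromℕ≤⊔ {b} X (inj₂ 8b≤3X) = ℚᵘₚ.p≤q⇒p≤r⊔q (fromℕ 2) (ℚᵘ.*≤* (begin
  + b ℤ.* + 8                   ≡⟨ ℤₚ.pos-* b 8 ⟨
  + (b * 8)                     ≤⟨ ℤ.+≤+ (≤-trans (≤-reflexive (*-comm b 8)) 8b≤3X) ⟩
  + (3 * X)                     ≡⟨ ℤₚ.pos-* 3 X ⟩
  + 3 ℤ.* + X                   ≡⟨ ℤₚ.*-identityʳ _ ⟨
  (+ 3 ℤ.* + X) ℤ.* + 1         ∎))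
  where open ℤₚ.≤-Reasoning

corollary5p12 : (n : ℕ) (L : List Rect) → All UnitHeight L →
    ∃[ β ] (Isβ n L β
    × β ≤∞ (fromℕ 2 ℚᵘ.⊔ (((+ 3) ℚᵘ./ 8) ℚᵘ.* fromℕ (maxWidth L ^ n * lcmOf (w L) ^ 2))))
corollary5p12 n L unit
  with ℓ≡ ← cong lcmOf (w-unitHeight unit)
  with B , beyond , bound ←
    threshold n unit (lcmOf (w L)) {{subst NonZero (sym ℓ≡) (lcmOf-widths≢0 L)}} (sym ℓ≡)
  -- The least valid bound is at most `B`, so it inherits the estimate for `B`.
  with b , b≤B , isβ ← leastBound (subtiles? n unit) B beyond =
  ⌊ b ⌋ , isβ ,
  fromℕ≤⊔ (maxWidth L ^ n * lcmOf (w L) ^ 2)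
    (Sum.map (≤-trans b≤B) (≤-trans (*-monoʳ-≤ 8 b≤B)) bound)
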